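{- For every finite nonempty alphabet $\Sigma$ and all positive integers $m,n$, there exists an $m$-shift de Bruijn sequence of order $n$ over $\Sigma$.
   Context: $\Sigma^n$ denotes the set of all words of length $n$ over $\Sigma$. For a word $w=a_1a_2\cdots a_\ell$, write $w[i..j]=a_i\cdots a_j$. A word $u$ of length $n$ appears in $w$ (as a factor) at a modulo $m$ position if $u=w[im+1..im+n]$ for some integer $i\ge 0$; distinct values of $i$ count as distinct appearances. An $m$-shift de Bruijn sequence of order $n$ over $\Sigma$ is a word $w$ over $\Sigma$, of length $m|\Sigma|^n+(n-m)$, such that each word in $\Sigma^n$ appears exactly once in $w$ as a factor at a modulo $m$ position. -}

module Defs where

open import Data.Fin.Base using (Fin)
open import Data.List.Base using (List; length; take; drop)
open import Data.Nat.Base using (ℕ; suc; _+_; _*_; _∸_; _^_; _≤_)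
open import Data.Product using (_×_; ∃!)
open import Function.Bundles using (_↔_)
open import Level using (Level)
open import Relation.Binary.PropositionalEquality using (_≡_)

private
  variable
    a : Level
    A : Set a

record Finite (A : Set a) : Set a where
  field
    size : ℕ
    enum : A ↔ Fin size

infix 10 _[_⋯_]

-- Letters are numbered from 1, and both endpoints are included.
_[_⋯_] : List A → ℕ → ℕ → List A
w [ i ⋯ j ] = take (suc j ∸ i) (drop (i ∸ 1) w)

-- The bound on `length w` is needed because `_[_⋯_]` silently truncates
-- ranges that run past the end of the word.
AppearsAt : {A : Set a} (m i : ℕ) → List A → List A → Set a
AppearsAt m i u w =
  (i * m + length u ≤ length w) × (u ≡ w [ i * m + 1 ⋯ i * m + length u ])

-- The subtraction in `length-w` is performed last: m may exceed n, but
-- m ≤ m * size ^ n for a nonempty alphabet, so it never truncates.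
record IsShiftDeBruijn {A : Set a} (F : Finite A) (m n : ℕ) (w : List A) : Set a where
  open Finite F
  field
    length-w     : length w ≡ (m * size ^ n + n) ∸ m
    appears-once : ∀ u → length u ≡ n → ∃! _≡_ (λ i → AppearsAt m i u w)

{-# OPTIONS --safe #-}

-- Take words of length n as edges from their first n ∸ m to their last n ∸ m letters.
-- An Eulerian trail of this graph spells the sequence.  It is built greedily from the
-- vertex a₀ … a₀, leaving for last at every vertex the edge that appends only a₀'s.
-- All vertices being balanced, it can only get stuck where it started.  If a vertex
-- still has an unused edge, then its a₀-edge is unused, so by balance the head of the
-- a₀-edge has an unused edge as well; following a₀-edges leads to a₀ … a₀, which has
-- none.  When m ≥ n there is a single vertex, and padding separates the words.

module Submission where

open import Data.Empty using (⊥-elim)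
open import Data.Fin.Base using (zero; suc; toℕ; fromℕ<)
open import Data.Fin.Properties using (toℕ<n; toℕ-fromℕ<) renaming (_≟_ to _≟ᶠ_)
open import Data.List.Base
  using (List; []; _∷_; [_]; _++_; length; map; take; drop; replicate; lookup;
         tabulate; cartesianProductWith)
open import Data.List.Membership.Propositional using (_∈_; find; lose)
open import Data.List.Membership.Propositional.Properties
  using (∈-∃++; ∈-map⁺; ∈-map⁻; ∈-lookup; ∈-tabulate⁺;
         ∈-cartesianProductWith⁺; ∈-cartesianProductWith⁻)
open import Data.List.Membership.Propositional.Properties.WithK using (unique∧set⇒bag)
open import Data.List.Properties
  using (≡-dec; ∷-injective; length-++; ++-assoc; length-map; length-take; length-drop;
         length-replicate; length-tabulate; take-all; drop-all; take-take; drop-drop;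
         take++drop≡id; map-∘; map-cong-local; map-id-local)
open import Data.List.Relation.Binary.BagAndSetEquality using (∼bag⇒↭)
open import Data.List.Relation.Binary.Permutation.Propositional
  using (_↭_; refl; prep; swap; ↭-sym; ↭-trans; ↭-reflexive; ↭⇒↭ₛ)
open import Data.List.Relation.Binary.Permutation.Propositional.Properties
  using (∈-resp-↭; All-resp-↭; ↭-length; shift; drop-∷)
  renaming (map⁺ to ↭-map⁺)
import Data.List.Relation.Binary.Permutation.Setoid.Properties as ↭ₛ
open import Data.List.Relation.Binary.Subset.Propositional.Properties using (⊆[]⇒≡[])
open import Data.List.Relation.Unary.All as All using (All; []; _∷_)
import Data.List.Relation.Unary.All.Properties as All
open import Data.List.Relation.Unary.AllPairs using ([]; _∷_)
open import Data.List.Relation.Unary.Any using (here; there; any?; index)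
open import Data.List.Relation.Unary.Any.Properties using (lookup-index)
open import Data.List.Relation.Unary.Unique.Propositional using (Unique)
import Data.List.Relation.Unary.Unique.Propositional.Properties as Unique
open import Data.Nat.Base
  using (ℕ; zero; suc; _+_; _*_; _∸_; _^_; _≤_; _⊓_; _<_; s≤s; s≤s⁻¹; NonZero; >-nonZero⁻¹)
open import Data.Nat.Properties hiding (_≟_)
open import Data.Product.Base using (∃; _×_; _,_; proj₁; proj₂)
open import Data.Sum.Base using (inj₁; inj₂)
open import Function.Base using (_∘_)
open import Function.Bundles using (mk⇔; module Inverse)
open import Function.Properties.Inverse using (↔⇒↣)
open import Level using (Level; _⊔_)
open import Relation.Binary.Definitions using (DecidableEquality)
open import Relation.Binary.PropositionalEquality
  using (_≡_; _≢_; refl; sym; trans; cong; cong₂; subst; setoid; module ≡-Reasoning)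
open import Relation.Nullary using (¬_; yes; no)
open import Relation.Nullary.Decidable using (_×-dec_; ¬?; via-injection; decidable-stable)
open import Defs

private
  variable
    a b : Level
    A B C : Set a

∈⇒↭∷ : ∀ {x : A} {xs} → x ∈ xs → ∃ λ ys → xs ↭ x ∷ ys
∈⇒↭∷ x∈xs with ys , zs , refl ← ∈-∃++ x∈xs = ys ++ zs , shift _ ys zs

-- Eulerian trails

module _ {E : Set a} {V : Set b} (src tgt : E → V) where

  data Trail : V → List E → V → Set (a ⊔ b) where
    []  : ∀ {v} → Trail v [] v
    _∷_ : ∀ {v es} e → Trail (tgt e) es v → Trail (src e) (e ∷ es) v

  module _ (exit : V → E) where

    -- Required of every source of an edge, this makes the exit edges a spanning tree directed
    -- towards `s`, as in the BEST theorem.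
    data Reaches (s : V) : V → Set b where
      here : Reaches s s
      step : ∀ {v} → Reaches s (tgt (exit v)) → Reaches s v

    -- The invariant of the greedy choice. `exit` is total on `V` but need not give an edge leaving
    -- a vertex from which no edge starts, so both claims are restricted to sources of edges in `U`.
    ExitsIn : List E → Set _
    ExitsIn U = ∀ {e} → e ∈ U → exit (src e) ∈ U × src (exit (src e)) ≡ src e

  module _ (_≟ᴱ_ : DecidableEquality E) (_≟ⱽ_ : DecidableEquality V) (exit : V → E) where

    -- U holds the unused edges and t is the current vertex.  The permutation says
    -- that in- and out-degrees in U balance except at the two ends of what remains.
    extend : ∀ n U {s t} → length U ≡ n → ExitsIn exit U →
             (∀ {e} → e ∈ U → Reaches exit s (src e)) →
             s ∷ map src U ↭ t ∷ map tgt U →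
             ∃ λ T → Trail t T s × T ↭ U

    -- One step of the walk along `e`. The final hypothesis lets an exit edge be used only when
    -- nothing else is left at its source; this preserves `ExitsIn`.
    extendBy : ∀ n U {s e} → length U ≡ n → ExitsIn exit U →
               (∀ {f} → f ∈ U → Reaches exit s (src f)) →
               s ∷ map src U ↭ src e ∷ map tgt U →
               e ∈ U → (e ≡ exit (src e) → ∀ {f} → f ∈ U → src f ≡ src e → f ≡ e) →
               ∃ λ T → Trail (src e) T s × T ↭ U

    finish : ∀ U {s t} → ExitsIn exit U → (∀ {e} → e ∈ U → Reaches exit s (src e)) →
            s ∷ map src U ↭ t ∷ map tgt U →
            (∀ {e} → e ∈ U → src e ≢ t) →
            ∃ λ T → Trail t T s × T ↭ U

    extend n U {s} {t} |U| exits reach bal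
      -- An edge other than the exit is sought first.
      with any? (λ e → (src e ≟ⱽ t) ×-dec ¬? (e ≟ᴱ exit t)) U
    ... | yes p with e , e∈U , refl , e≢ ← find p =
      extendBy n U |U| exits reach bal e∈U (λ e≡ → ⊥-elim (e≢ e≡))
    ... | no ¬p with any? (λ e → src e ≟ⱽ t) U
    ...   | no ¬q = finish U exits reach bal (λ e∈U eq → ¬q (lose e∈U eq))
    ...   | yes q with e , e∈U , refl ← find q =
      extendBy n U |U| exits reach bal e∈U
        (λ e≡ f∈U eq → trans (onlyExit f∈U eq) (sym e≡))
      where
      onlyExit : ∀ {f} → f ∈ U → src f ≡ src e → f ≡ exit (src e)
      onlyExit {f} f∈U eq = decidable-stable (f ≟ᴱ exit (src e))
        (λ f≢ → ¬p (lose f∈U (eq , f≢)))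

    extendBy n U {s} {e} |U| exits reach bal e∈U last
      with U′ , U↭ ← ∈⇒↭∷ e∈U
      -- The length `n` is what decreases in the mutual recursion; having `e` in `U` rules out zero.
      with n | trans (sym |U|) (↭-length U↭)
    ... | suc n′ | |U′| = e ∷ proj₁ rest , e ∷ proj₁ (proj₂ rest)
                        , ↭-trans (prep e (proj₂ (proj₂ rest))) (↭-sym U↭)
      where
      inU : ∀ {f} → f ∈ U′ → f ∈ U
      inU f∈ = ∈-resp-↭ (↭-sym U↭) (there f∈)

      exits′ : ExitsIn exit U′
      exits′ {f} f∈ with exits (inU f∈)
      ... | x∈U , sx with ∈-resp-↭ U↭ x∈U
      ...   | there x∈ = x∈ , sx
      -- The removed edge was the exit at `src f`. As `U` may contain repetitions, `f` is then
      -- another copy of it, still in `U′`.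
      ...   | here x≡e = subst (_∈ U′) (trans f≡e (sym x≡e)) f∈ , sx
        where
        srcf : src f ≡ src e
        srcf = trans (sym sx) (cong src x≡e)
        f≡e : f ≡ e
        f≡e = last (trans (sym x≡e) (cong exit srcf)) (inU f∈) srcf

      bal′ : s ∷ map src U′ ↭ tgt e ∷ map tgt U′
      -- Once `src e` heads both sides it cancels, leaving `tgt e` as the new current vertex.
      bal′ = drop-∷ (↭-trans (swap _ _ refl)
               (↭-trans (prep s (↭-map⁺ src (↭-sym U↭)))
               (↭-trans bal (prep (src e) (↭-map⁺ tgt U↭)))))

      rest : ∃ λ T → Trail (tgt e) T s × T ↭ U′
      rest = extend n′ U′ (sym (suc-injective |U′|)) exits′ (λ f∈ → reach (inU f∈)) bal′

    finish U {s} {t} exits reach bal none with ∈-resp-↭ (↭-sym bal) (here refl)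
    ... | there t∈ with e , e∈U , t≡ ← ∈-map⁻ src t∈ = ⊥-elim (none e∈U (sym t≡))
    ... | here refl = [] , [] , ↭-reflexive (sym (⊆[]⇒≡[] (λ e∈U → ⊥-elim (unused e∈U))))
      where
      deadEnd : ∀ {v} → Reaches exit s v → ¬ (v ∈ map src U)
      deadEnd r v∈ with e , e∈U , refl ← ∈-map⁻ src v∈ with r
      ... | here   = none e∈U refl
      ... | step r = deadEnd r (∈-resp-↭ (↭-sym (drop-∷ bal))
                                  (∈-map⁺ tgt (proj₁ (exits e∈U))))

      unused : ∀ {e} → ¬ (e ∈ U)
      unused e∈U = deadEnd (reach e∈U) (∈-map⁺ src e∈U)

-- Words

module _ {A : Set a} where

  take-++-exact : ∀ {k} (xs ys : List A) → length xs ≡ k → take k (xs ++ ys) ≡ xs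
  take-++-exact []       ys refl = refl
  take-++-exact (x ∷ xs) ys refl = cong (x ∷_) (take-++-exact xs ys refl)

  drop-++-exact : ∀ {k} (xs ys : List A) → length xs ≡ k → drop k (xs ++ ys) ≡ ys
  drop-++-exact []       ys refl = refl
  drop-++-exact (x ∷ xs) ys refl = drop-++-exact xs ys refl

  take-+-++ : ∀ {k} l (xs ys : List A) → length xs ≡ k →
              take (k + l) (xs ++ ys) ≡ xs ++ take l ys
  take-+-++ l []       ys refl = refl
  take-+-++ l (x ∷ xs) ys refl = cong (x ∷_) (take-+-++ l xs ys refl)

  All-drop-++ : ∀ {p} {P : A → Set p} k (xs : List A) {ys} →
                All P (drop k xs) → All P ys → All P (drop k (xs ++ ys))
  All-drop-++ zero    xs       pxs pys = All.++⁺ pxs pys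
  All-drop-++ (suc k) []       pxs pys = All.drop⁺ (suc k) pys
  All-drop-++ (suc k) (x ∷ xs) pxs pys = All-drop-++ k xs pxs pys

  All-≡⇒replicate : ∀ {x : A} {xs} → All (_≡ x) xs → xs ≡ replicate (length xs) x
  All-≡⇒replicate []           = refl
  All-≡⇒replicate (refl ∷ pxs) = cong (_ ∷_) (All-≡⇒replicate pxs)

  lookup-injective : ∀ {xs : List A} → Unique xs → ∀ {i j} →
                     lookup xs i ≡ lookup xs j → i ≡ j
  lookup-injective (_ ∷ _)  {zero}  {zero}  _  = refl
  lookup-injective (x∉ ∷ _) {zero}  {suc j} eq = ⊥-elim (All.lookup x∉ (∈-lookup j) eq)
  lookup-injective (x∉ ∷ _) {suc i} {zero}  eq = ⊥-elim (All.lookup x∉ (∈-lookup i) (sym eq))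
  lookup-injective (_ ∷ u)  {suc i} {suc j} eq = cong suc (lookup-injective u eq)

  rotate : ℕ → List A → List A
  rotate k xs = drop k xs ++ take k xs

  length-rotate : ∀ k xs → length (rotate k xs) ≡ length xs
  length-rotate k xs = begin
    length (drop k xs ++ take k xs)          ≡⟨ length-++ (drop k xs) ⟩
    length (drop k xs) + length (take k xs)  ≡⟨ +-comm (length (drop k xs)) _ ⟩
    length (take k xs) + length (drop k xs)  ≡⟨ length-++ (take k xs) ⟨
    length (take k xs ++ drop k xs)          ≡⟨ cong length (take++drop≡id k xs) ⟩
    length xs                                ∎
    where open ≡-Reasoning

  rotate-rotate : ∀ k l xs → length xs ≡ k + l → rotate l (rotate k xs) ≡ xs
  rotate-rotate k l xs |xs| = trans
    (cong₂ _++_ (drop-++-exact (drop k xs) (take k xs) |drop|)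
                (take-++-exact (drop k xs) (take k xs) |drop|))
    (take++drop≡id k xs)
    where
    |drop| : length (drop k xs) ≡ l
    |drop| = trans (length-drop k xs) (trans (cong (_∸ k) |xs|) (m+n∸m≡n k l))

length-cartesianProductWith : ∀ (f : A → B → C) xs ys →
  length (cartesianProductWith f xs ys) ≡ length xs * length ys
length-cartesianProductWith f []       ys = refl
length-cartesianProductWith f (x ∷ xs) ys = trans (length-++ (map (f x) ys))
  (cong₂ _+_ (length-map (f x) ys) (length-cartesianProductWith f xs ys))

-- Enumeration of the words of a given length.

module _ {A : Set a} (letters : List A) (unique : Unique letters)
         (complete : ∀ x → x ∈ letters) where

  words : ℕ → List (List A)
  words zero    = [ [] ]
  words (suc n) = cartesianProductWith _∷_ letters (words n)

  length-words : ∀ n → length (words n) ≡ length letters ^ n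
  length-words zero    = refl
  length-words (suc n) = trans (length-cartesianProductWith _∷_ letters (words n))
    (cong (length letters *_) (length-words n))

  words-unique : ∀ n → Unique (words n)
  words-unique zero    = [] ∷ []
  words-unique (suc n) = Unique.cartesianProductWith⁺ _∷_ ∷-injective unique (words-unique n)

  ∈-words⁺ : ∀ {n} w → length w ≡ n → w ∈ words n
  ∈-words⁺ []      refl = here refl
  ∈-words⁺ (x ∷ w) refl = ∈-cartesianProductWith⁺ _∷_ (complete x) (∈-words⁺ w refl)

  ∈-words⁻ : ∀ n {w} → w ∈ words n → length w ≡ n
  ∈-words⁻ zero    (here refl) = refl
  ∈-words⁻ (suc n) w∈
    with _ , v , _ , v∈ , refl ← ∈-cartesianProductWith⁻ _∷_ letters (words n) w∈
    = cong suc (∈-words⁻ n v∈)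

  -- Rotation by `n ∸ d` inverts rotation by `d`, so both lists are free of repetitions and have the
  -- same members.
  rotate-words : ∀ {n} d → d ≤ n → map (rotate d) (words n) ↭ words n
  rotate-words {n} d d≤n = ∼bag⇒↭ (unique∧set⇒bag unique′ (words-unique n) (mk⇔ to from))
    where
    c = n ∸ d

    unique′ : Unique (map (rotate d) (words n))
    unique′ = Unique.map⁻ {f = rotate c} (subst Unique (sym inverse) (words-unique n))
      where
      inverse : map (rotate c) (map (rotate d) (words n)) ≡ words n
      inverse = trans (sym (map-∘ (words n))) (map-id-local (All.tabulate λ {w} w∈ →
        rotate-rotate d c w (trans (∈-words⁻ n w∈) (sym (m+[n∸m]≡n d≤n)))))

    to : ∀ {w} → w ∈ map (rotate d) (words n) → w ∈ words n
    to w∈ with v , v∈ , refl ← ∈-map⁻ (rotate d) w∈ =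
      ∈-words⁺ _ (trans (length-rotate d v) (∈-words⁻ n v∈))

    from : ∀ {w} → w ∈ words n → w ∈ map (rotate d) (words n)
    from {w} w∈ = subst (_∈ _)
      (rotate-rotate c d w (trans (∈-words⁻ n w∈) (sym (m∸n+n≡m d≤n))))
      (∈-map⁺ (rotate d) (∈-words⁺ _ (trans (length-rotate c w) (∈-words⁻ n w∈))))

-- Spelling a trail

module _ {A : Set a} (a₀ : A) (m n : ℕ) where

  private
    d = n ∸ m

  Overlap : List A → List (List A) → List A → Set a
  Overlap = Trail (take d) (drop m)

  -- The letters of `e` not shared with its successor if `m ≤ n`, and all of `e` padded to length
  -- `m` otherwise.
  block : List A → List A
  block e = take m e ++ replicate (m ∸ n) a₀

  spell : List (List A) → List A
  spell []           = []
  -- The last word is kept whole and unpadded, so that `k` words give length `(k ∸ 1) * m + n`.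
  spell (e ∷ [])     = e
  spell (e ∷ f ∷ es) = block e ++ spell (f ∷ es)

  length-block : ∀ e → length e ≡ n → length (block e) ≡ m
  length-block e refl = begin
    length (block e)                           ≡⟨ length-++ (take m e) ⟩
    length (take m e) + length (replicate (m ∸ n) a₀)
      ≡⟨ cong₂ _+_ (length-take m e) (length-replicate (m ∸ n)) ⟩
    m ⊓ n + (m ∸ n)                            ≡⟨ cong (_+ (m ∸ n)) (⊓-comm m n) ⟩
    n ⊓ m + (m ∸ n)                            ≡⟨ m⊓n+n∸m≡n n m ⟩
    m                                          ∎
    where open ≡-Reasoning

  drop-spell : ∀ e f es → length e ≡ n → drop m (spell (e ∷ f ∷ es)) ≡ spell (f ∷ es)
  drop-spell e f es |e| = drop-++-exact (block e) _ (length-block e |e|)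

  length-spell : ∀ e es → All (λ f → length f ≡ n) (e ∷ es) →
                 length (spell (e ∷ es)) ≡ length es * m + n
  length-spell e []       (|e| ∷ _)   = |e|
  length-spell e (f ∷ es) (|e| ∷ |es|) = begin
    length (spell (e ∷ f ∷ es))                ≡⟨ length-++ (block e) ⟩
    length (block e) + length (spell (f ∷ es))
      ≡⟨ cong₂ _+_ (length-block e |e|) (length-spell f es |es|) ⟩
    m + (length es * m + n)                    ≡⟨ +-assoc m _ n ⟨
    length (f ∷ es) * m + n                    ∎
    where open ≡-Reasoning

  -- If `n ≤ m`, the block starts with all of `e`. Otherwise it supplies `m` letters, and the other
  -- `d` begin the next word `f`, since the target of `e` is the source of `f`.
  take-spell : ∀ {u v} e es → Overlap u (e ∷ es) v → All (λ f → length f ≡ n) (e ∷ es) →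
               take n (spell (e ∷ es)) ≡ e
  take-spell e []       _ (|e| ∷ _) = take-all n e (≤-reflexive |e|)
  take-spell e (f ∷ es) (.e ∷ trail) (|e| ∷ |es|) with ≤-total n m
  ... | inj₁ n≤m = begin
    take n (block e ++ spell (f ∷ es))
      ≡⟨ cong (take n) (++-assoc (take m e) _ _) ⟩
    take n (take m e ++ replicate (m ∸ n) a₀ ++ spell (f ∷ es))
      ≡⟨ cong (λ xs → take n (xs ++ replicate (m ∸ n) a₀ ++ spell (f ∷ es)))
           (take-all m e (≤-trans (≤-reflexive |e|) n≤m)) ⟩
    take n (e ++ replicate (m ∸ n) a₀ ++ spell (f ∷ es))
      ≡⟨ take-++-exact e _ |e| ⟩
    e ∎
    where open ≡-Reasoning
  ... | inj₂ m≤n = begin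
    take n (block e ++ spell (f ∷ es))
      ≡⟨ cong (take n) (++-assoc (take m e) _ _) ⟩
    take n (take m e ++ replicate (m ∸ n) a₀ ++ spell (f ∷ es))
      ≡⟨ cong (λ k → take n (take m e ++ replicate k a₀ ++ spell (f ∷ es))) (m≤n⇒m∸n≡0 m≤n) ⟩
    take n (take m e ++ spell (f ∷ es))
      ≡⟨ cong (λ k → take k (take m e ++ spell (f ∷ es))) (m+[n∸m]≡n m≤n) ⟨
    take (m + d) (take m e ++ spell (f ∷ es))
      ≡⟨ take-+-++ d (take m e) _ (trans (length-take m e)
           (m≤n⇒m⊓n≡m (≤-trans m≤n (≤-reflexive (sym |e|))))) ⟩
    take m e ++ take d (spell (f ∷ es))
      ≡⟨ cong (λ k → take m e ++ take k (spell (f ∷ es))) (m≤n⇒m⊓n≡m (m∸n≤m n m)) ⟨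
    take m e ++ take (d ⊓ n) (spell (f ∷ es))
      ≡⟨ cong (take m e ++_) (take-take d n _) ⟨
    take m e ++ take d (take n (spell (f ∷ es)))
      ≡⟨ cong (λ xs → take m e ++ take d xs) (take-spell f es trail |es|) ⟩
    take m e ++ take d f
      ≡⟨ cong (take m e ++_) (source trail) ⟨
    take m e ++ drop m e
      ≡⟨ take++drop≡id m e ⟩
    e ∎
    where
    open ≡-Reasoning
    source : ∀ {u v f es} → Overlap u (f ∷ es) v → u ≡ take d f
    source (_ ∷ _) = refl

  window-spell : ∀ {u v} es → Overlap u es v → All (λ f → length f ≡ n) es →
                 ∀ i → take n (drop (toℕ i * m) (spell es)) ≡ lookup es i
  window-spell (e ∷ es)     trail        |es|         zero    = take-spell e es trail |es|
  window-spell (e ∷ f ∷ es) (.e ∷ trail) (|e| ∷ |es|) (suc i) = begin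
    take n (drop (m + toℕ i * m) (spell (e ∷ f ∷ es)))
      ≡⟨ cong (take n) (drop-drop m (toℕ i * m) _) ⟨
    take n (drop (toℕ i * m) (drop m (spell (e ∷ f ∷ es))))
      ≡⟨ cong (take n ∘ drop (toℕ i * m)) (drop-spell e f es |e|) ⟩
    take n (drop (toℕ i * m) (spell (f ∷ es)))
      ≡⟨ window-spell (f ∷ es) trail |es| i ⟩
    lookup (f ∷ es) i ∎
    where open ≡-Reasoning

-- Appearances in a spelled trail.

[⋯]≡take-drop : ∀ (w : List A) k n → w [ k + 1 ⋯ k + n ] ≡ take n (drop k w)
[⋯]≡take-drop w k n = cong₂ (λ i j → take i (drop j w))
  (trans (cong (suc (k + n) ∸_) (+-comm k 1)) (m+n∸m≡n k n))
  (m+n∸n≡m k 1)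

appears-once : ∀ {A : Set a} (a₀ : A) m n .{{_ : NonZero m}} {u v} e es →
  Overlap a₀ m n u (e ∷ es) v → All (λ f → length f ≡ n) (e ∷ es) → Unique (e ∷ es) →
  ∀ {x} → x ∈ e ∷ es →
  ∃ λ i → AppearsAt m i x (spell a₀ m n (e ∷ es)) ×
          (∀ {j} → AppearsAt m j x (spell a₀ m n (e ∷ es)) → i ≡ j)
appears-once a₀ m n e es trail |es| unique {x} x∈
  with refl ← All.lookup |es| x∈ = toℕ i , (fits , occurs) , once
  where
  w = spell a₀ m n (e ∷ es)
  i = index x∈

  |w| : length w ≡ length es * m + n
  |w| = length-spell a₀ m n e es |es|

  fits : toℕ i * m + n ≤ length w
  fits = ≤-trans (+-monoˡ-≤ n (*-monoˡ-≤ m (s≤s⁻¹ (toℕ<n i)))) (≤-reflexive (sym |w|))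

  occurs : x ≡ w [ toℕ i * m + 1 ⋯ toℕ i * m + n ]
  occurs = trans (lookup-index x∈)
    (sym (trans ([⋯]≡take-drop w (toℕ i * m) n) (window-spell a₀ m n (e ∷ es) trail |es| i)))

  once : ∀ {j} → AppearsAt m j x w → toℕ i ≡ j
  once {j} (fits′ , occurs′) = trans (cong toℕ (lookup-injective unique same)) (toℕ-fromℕ< j<)
    where
    -- The length bound in `AppearsAt` makes `j` an index of the trail, where absence of repetitions
    -- decides.
    j< : j < length (e ∷ es)
    j< = s≤s (*-cancelʳ-≤ j (length es) m
           (+-cancelʳ-≤ n (j * m) (length es * m) (≤-trans fits′ (≤-reflexive |w|))))

    same : lookup (e ∷ es) i ≡ lookup (e ∷ es) (fromℕ< j<)
    same = begin
      lookup (e ∷ es) i              ≡⟨ lookup-index x∈ ⟨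
      x                              ≡⟨ occurs′ ⟩
      w [ j * m + 1 ⋯ j * m + n ]    ≡⟨ [⋯]≡take-drop w (j * m) n ⟩
      take n (drop (j * m) w)        ≡⟨ cong (λ k → take n (drop (k * m) w)) (toℕ-fromℕ< j<) ⟨
      take n (drop (toℕ (fromℕ< j<) * m) w)
        ≡⟨ window-spell a₀ m n (e ∷ es) trail |es| (fromℕ< j<) ⟩
      lookup (e ∷ es) (fromℕ< j<)    ∎
      where open ≡-Reasoning

-- The overlap graph on all words of length `n`.

module _ {A : Set a} (_≟_ : DecidableEquality A) (letters : List A)
         (unique : Unique letters) (complete : ∀ x → x ∈ letters) (a₀ : A)
         (m n : ℕ) .{{_ : NonZero m}} where

  private
    d = n ∸ m
    W = words letters unique complete n
    root = replicate d a₀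

    d≤n : d ≤ n
    d≤n = m∸n≤m n m

    -- Here `n ∸ d` is the minimum of `m` and `n`, which gives length `n` in both regimes.
    exit : List A → List A
    exit v = v ++ replicate (n ∸ d) a₀

    length-exit : ∀ v → length v ≡ d → length (exit v) ≡ n
    length-exit v |v| = begin
      length (exit v)                                ≡⟨ length-++ v ⟩
      length v + length (replicate (n ∸ d) a₀)       ≡⟨ cong₂ _+_ |v| (length-replicate (n ∸ d)) ⟩
      d + (n ∸ d)                                    ≡⟨ m+[n∸m]≡n d≤n ⟩
      n                                              ∎
      where open ≡-Reasoning

    length-source : ∀ {e} → e ∈ W → length (take d e) ≡ d
    length-source {e} e∈ = trans (length-take d e) (m≤n⇒m⊓n≡m
      (≤-trans d≤n (≤-reflexive (sym (∈-words⁻ letters unique complete n e∈)))))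

    exits : ExitsIn (take d) (drop m) exit W
    exits {e} e∈ = ∈-words⁺ letters unique complete _ (length-exit (take d e) (length-source e∈))
                 , take-++-exact (take d e) _ (length-source e∈)

    -- c counts the letters of v that have not yet been shifted out.
    reaches : ∀ c v → length v ≡ d → All (_≡ a₀) (drop c v) →
              Reaches (take d) (drop m) exit root v
    reaches zero v |v| a₀s = subst (Reaches _ _ exit root)
      (sym (trans (All-≡⇒replicate a₀s) (cong (λ k → replicate k a₀) |v|))) here
    -- As `m` is positive, the exit edge shifts out at least one letter, and those it appends are
    -- all `a₀`.
    reaches (suc c) v |v| a₀s = step (reaches c (drop m (exit v))
      (trans (length-drop m (exit v)) (cong (_∸ m) (length-exit v |v|)))
      (subst (All (_≡ a₀)) eq (All.drop⁺ (m ∸ 1)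
        (All-drop-++ (suc c) v a₀s (All.replicate⁺ (n ∸ d) refl)))))
      where
      open ≡-Reasoning
      eq : drop (m ∸ 1) (drop (suc c) (exit v)) ≡ drop c (drop m (exit v))
      eq = begin
        drop (m ∸ 1) (drop (suc c) (exit v))  ≡⟨ drop-drop (suc c) (m ∸ 1) (exit v) ⟩
        drop (suc c + (m ∸ 1)) (exit v)       ≡⟨ cong (λ k → drop k (exit v)) shifted ⟩
        drop (m + c) (exit v)                 ≡⟨ drop-drop m c _ ⟨
        drop c (drop m (exit v))              ∎
        where
        shifted : suc c + (m ∸ 1) ≡ m + c
        shifted = begin
          suc c + (m ∸ 1)   ≡⟨ +-suc c (m ∸ 1) ⟨
          c + suc (m ∸ 1)   ≡⟨ cong (c +_) (m+[n∸m]≡n (>-nonZero⁻¹ m)) ⟩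
          c + m             ≡⟨ +-comm c m ⟩
          m + c             ∎

    -- Rotating a word by d turns its source into its target.
    balanced : map (take d) W ↭ map (drop m) W
    balanced = ↭-trans (↭-reflexive sources)
      (↭-map⁺ (drop m) (rotate-words letters unique complete d d≤n))
      where
      target : ∀ {e} → length e ≡ n → take d e ≡ drop m (rotate d e)
      -- If `m ≤ n`, then `drop d e` has length `m`, so dropping it from the rotation leaves
      -- `take d e`. Otherwise both sides are empty.
      target {e} |e| with ≤-total m n
      ... | inj₁ m≤n = sym (drop-++-exact (drop d e) _
        (trans (length-drop d e) (trans (cong (_∸ d) |e|) (m∸[m∸n]≡n m≤n))))
      ... | inj₂ n≤m = trans (cong (λ k → take k e) (m≤n⇒m∸n≡0 n≤m))
        (sym (drop-all m (rotate d e)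
          (≤-trans (≤-reflexive (trans (length-rotate d e) |e|)) n≤m)))

      sources : map (take d) W ≡ map (drop m) (map (rotate d) W)
      sources = trans
        (map-cong-local (All.tabulate λ e∈ → target (∈-words⁻ letters unique complete n e∈)))
        (map-∘ W)

  eulerianTrail : ∃ λ T → Overlap a₀ m n root T root × T ↭ W
  eulerianTrail = extend (take d) (drop m) (≡-dec _≟_) (≡-dec _≟_) exit (length W) W refl exits
    (λ {e} e∈ → reaches d (take d e) (length-source e∈)
      (subst (All (_≡ a₀)) (sym (drop-all d (take d e) (≤-reflexive (length-source e∈)))) []))
    (prep root balanced)

  shiftDeBruijn : ∃ λ w → length w ≡ (m * length letters ^ n + n) ∸ m ×
    (∀ u → length u ≡ n → ∃ λ i → AppearsAt m i u w × (∀ {j} → AppearsAt m j u w → i ≡ j))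
  shiftDeBruijn with eulerianTrail
  -- The trail is nonempty because it contains the word of `n` letters `a₀`.
  ... | [] , _ , T↭W with () ← ∈-resp-↭ (↭-sym T↭W)
          (∈-words⁺ letters unique complete (replicate n a₀) (length-replicate n))
  ... | T@(e ∷ es) , trail , T↭W = spell a₀ m n T , |w| ,
          λ u |u| → appears-once a₀ m n e es trail |T|
            (↭ₛ.Unique-resp-↭ (setoid _) (↭⇒↭ₛ (↭-sym T↭W)) (words-unique letters unique complete n))
            (∈-resp-↭ (↭-sym T↭W) (∈-words⁺ letters unique complete u |u|))
    where
    open ≡-Reasoning
    |T| : All (λ f → length f ≡ n) T
    |T| = All-resp-↭ (↭-sym T↭W) (All.tabulate (∈-words⁻ letters unique complete n))

    |w| : length (spell a₀ m n T) ≡ (m * length letters ^ n + n) ∸ m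
    |w| = begin
      length (spell a₀ m n T)                   ≡⟨ length-spell a₀ m n e es |T| ⟩
      -- `es` has one word fewer than `T`; adding and subtracting `m` accounts for it.
      length es * m + n                         ≡⟨ m+n∸m≡n m _ ⟨
      (m + (length es * m + n)) ∸ m             ≡⟨ cong (_∸ m) (+-assoc m _ n) ⟨
      (length T * m + n) ∸ m                    ≡⟨ cong (λ k → (k + n) ∸ m) (*-comm (length T) m) ⟩
      (m * length T + n) ∸ m
        ≡⟨ cong (λ k → (m * k + n) ∸ m)
             (trans (↭-length T↭W) (length-words letters unique complete n)) ⟩
      (m * length letters ^ n + n) ∸ m          ∎

-- From a list of letters to a `Finite` alphabet.

theorem4 : ∀ {a : Level} {A : Set a} (F : Finite A) → A →
    (m n : ℕ) → .{{NonZero m}} → .{{NonZero n}} →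
    ∃ (λ (w : List A) → IsShiftDeBruijn F m n w)
theorem4 {A = A} F a₀ m n =
  let w , |w| , once = shiftDeBruijn (via-injection (↔⇒↣ enum) _≟ᶠ_) letters
                         (Unique.tabulate⁺ from-injective) complete a₀ m n
  in w , record
    { length-w     = trans |w| (cong (λ k → (m * k ^ n + n) ∸ m) (length-tabulate from))
    ; appears-once = once
    }
  where
  open Finite F
  open Inverse enum using (to; from; strictlyInverseˡ; strictlyInverseʳ)

  letters : List A
  letters = tabulate from

  from-injective : ∀ {i j} → from i ≡ from j → i ≡ j
  from-injective {i} {j} eq =
    trans (sym (strictlyInverseˡ i)) (trans (cong to eq) (strictlyInverseˡ j))

  complete : ∀ x → x ∈ letters
  complete x = subst (_∈ letters) (strictlyInverseʳ x) (∈-tabulate⁺ (to x))
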